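{- The class $\mathcal{EL}(\mathcal Q_p[\bigcirc,\Diamond])$ is not polynomially characterisable; that is, there is no polynomial $f$ such that every $q\in\mathcal{EL}(\mathcal Q_p[\bigcirc,\Diamond])$ is uniquely characterised within $\mathcal{EL}(\mathcal Q_p[\bigcirc,\Diamond])$ by some example set $E$ with $|E|\le f(|q|)$.
   Context: **Data.** A (relational) data instance $\mathcal A$ is a finite set of facts $A(a)$ and $P(a,b)$ with $A$ a unary predicate symbol, $P$ a binary predicate symbol and $a,b$ individual names; $\mathrm{ind}(\mathcal A)$ is the set of individual names in it. A temporal data instance is a finite sequence $\mathcal D=\mathcal A_0,\dots,\mathcal A_n$ of data instances, with $\mathcal A_\ell=\emptyset$ for $\ell>n$; $\mathrm{ind}(\mathcal D)=\bigcup_i\mathrm{ind}(\mathcal A_i)$ and $|\mathcal D|=\sum_i|\mathcal A_i|$. **Queries.** $\mathcal Q[\bigcirc,\Diamond]\otimes\mathcal{EL}$ is the set of queries built from $\top$ and unary predicate symbols $A$ using $\wedge$, $\exists P.q$ ($P$ a binary predicate symbol), $\bigcirc q$ and $\Diamond q$. Truth: $\mathcal D,a,\ell\models A$ iff $A(a)\in\mathcal A_\ell$; $\mathcal D,a,\ell\models\exists P.q$ iff there is $b\in\mathrm{ind}(\mathcal A_\ell)$ with $P(a,b)\in\mathcal A_\ell$ and $\mathcal D,b,\ell\models q$; $\mathcal D,a,\ell\models\bigcirc q$ iff $\mathcal D,a,\ell+1\models q$; $\mathcal D,a,\ell\models\Diamond q$ iff $\mathcal D,a,m\models q$ for some $m>\ell$;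 $\top$ and $\wedge$ as usual. $\mathcal Q_p[\bigcirc,\Diamond]\otimes\mathcal{EL}$ consists of those $q$ such that for any subquery $q_1\wedge q_2$ of $q$, at least one of $q_1,q_2$ has no occurrence of $\bigcirc$ or $\Diamond$ that is not in the scope of some $\exists P$. $\mathcal{EL}(\mathcal Q_p[\bigcirc,\Diamond])$ is the class of queries in $\mathcal Q_p[\bigcirc,\Diamond]\otimes\mathcal{EL}$ that contain no $\exists P$ in the scope of a temporal operator. $|q|$ is the number of symbols in $q$; $q\equiv q'$ means that $q,q'$ are true at the same $(\mathcal D,a,\ell)$. **Characterisability.** An example set is a pair $E=(E^+,E^-)$ of finite sets of pointed temporal data instances $(\mathcal D,a)$ with $a\in\mathrm{ind}(\mathcal D)$; $|E|$ is the sum of $|\mathcal D|$ over all examples. $q$ fits $E$ if $\mathcal D,a,0\models q$ for all $(\mathcal D,a)\in E^+$ and $\mathcal D,a,0\not\models q$ for all $(\mathcal D,a)\in E^-$. $E$ uniquely characterises $q$ within $\mathcal Q$ if $q$ fits $E$ and $q\equiv q'$ for all $q'\in\mathcal Q$ fitting $E$. -}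

module Defs where

open import Data.Empty using (⊥)
open import Data.List.Base using (List; []; _∷_; _++_; concatMap; foldr; length; map; sum)
open import Data.List.Membership.Propositional using (_∈_)
open import Data.List.NonEmpty.Base using (List⁺; toList)
open import Data.List.Relation.Binary.Pointwise using (Pointwise)
open import Data.List.Relation.Binary.Subset.Propositional using (_⊆_)
open import Data.List.Relation.Unary.All using (All)
open import Data.List.Relation.Unary.AllPairs using (AllPairs; [])
open import Data.List.Relation.Unary.Unique.Propositional using (Unique)
open import Data.Nat.Base using (ℕ; zero; suc; _+_; _*_; _≤_; _>_)
open import Data.Product.Base using (_×_; Σ-syntax; ∃-syntax)
open import Data.Sum.Base using (_⊎_)
open import Data.Unit.Base using (⊤)
open import Function.Bundles using (_⇔_)
open import Relation.Binary.PropositionalEquality.Core using (_≡_)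
open import Relation.Nullary.Negation.Core using (¬_)

-- Countably infinite supplies of symbols.

UnaryPredicate BinaryPredicate Individual : Set
UnaryPredicate  = ℕ
BinaryPredicate = ℕ
Individual      = ℕ

data Fact : Set where
  unary  : UnaryPredicate → Individual → Fact
  binary : BinaryPredicate → Individual → Individual → Fact

-- Finite sets are duplicate-free lists, so that cardinality is length.

record DataInstance : Set where
  constructor mkInstance
  field
    facts  : List Fact
    unique : Unique facts

open DataInstance public

∅ : DataInstance
∅ = mkInstance [] []

individuals : Fact → List Individual
individuals (unary A a)    = a ∷ []
individuals (binary P a b) = a ∷ b ∷ []

ind : DataInstance → List Individual
ind 𝒜 = concatMap individuals (facts 𝒜)

_≈ᴬ_ : DataInstance → DataInstance → Set
𝒜 ≈ᴬ ℬ = facts 𝒜 ⊆ facts ℬ × facts ℬ ⊆ facts 𝒜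

TemporalInstance : Set
TemporalInstance = List⁺ DataInstance

at : List DataInstance → ℕ → DataInstance
at []       ℓ       = ∅
at (𝒜 ∷ 𝒜s) zero    = 𝒜
at (𝒜 ∷ 𝒜s) (suc ℓ) = at 𝒜s ℓ

infix 20 _⟨_⟩

_⟨_⟩ : TemporalInstance → ℕ → DataInstance
𝒟 ⟨ ℓ ⟩ = at (toList 𝒟) ℓ

indᵀ : TemporalInstance → List Individual
indᵀ 𝒟 = concatMap ind (toList 𝒟)

sizeᵀ : TemporalInstance → ℕ
sizeᵀ 𝒟 = sum (map (λ 𝒜 → length (facts 𝒜)) (toList 𝒟))

_≈ᵀ_ : TemporalInstance → TemporalInstance → Set
𝒟 ≈ᵀ 𝒟′ = Pointwise _≈ᴬ_ (toList 𝒟) (toList 𝒟′)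

infixr 6 _∧_
infixr 7 ○_ ◇_ ∃⟨_⟩_

data Query : Set where
  ⊤q     : Query
  atom   : UnaryPredicate → Query
  _∧_    : Query → Query → Query
  ∃⟨_⟩_  : BinaryPredicate → Query → Query
  ○_ ◇_  : Query → Query

infix 4 _,_,_⊨_

_,_,_⊨_ : TemporalInstance → Individual → ℕ → Query → Set
𝒟 , a , ℓ ⊨ ⊤q         = ⊤
𝒟 , a , ℓ ⊨ atom A     = unary A a ∈ facts (𝒟 ⟨ ℓ ⟩)
𝒟 , a , ℓ ⊨ q₁ ∧ q₂    = (𝒟 , a , ℓ ⊨ q₁) × (𝒟 , a , ℓ ⊨ q₂)
𝒟 , a , ℓ ⊨ ∃⟨ P ⟩ q   = ∃[ b ] (b ∈ ind (𝒟 ⟨ ℓ ⟩)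
                               × binary P a b ∈ facts (𝒟 ⟨ ℓ ⟩)
                               × (𝒟 , b , ℓ ⊨ q))
𝒟 , a , ℓ ⊨ ○ q        = 𝒟 , a , suc ℓ ⊨ q
𝒟 , a , ℓ ⊨ ◇ q        = ∃[ m ] (m > ℓ × (𝒟 , a , m ⊨ q))

infix 4 _≡q_

_≡q_ : Query → Query → Set
q ≡q q′ = ∀ 𝒟 a ℓ → (𝒟 , a , ℓ ⊨ q) ⇔ (𝒟 , a , ℓ ⊨ q′)

-- ∃P counts as two symbols, ∃ and P; brackets are not counted.
∣_∣ : Query → ℕ
∣ ⊤q ∣       = 1
∣ atom A ∣   = 1
∣ q₁ ∧ q₂ ∣  = 1 + ∣ q₁ ∣ + ∣ q₂ ∣
∣ ∃⟨ P ⟩ q ∣ = 2 + ∣ q ∣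
∣ ○ q ∣      = 1 + ∣ q ∣
∣ ◇ q ∣      = 1 + ∣ q ∣

infix 4 _⊑_

data _⊑_ (r : Query) : Query → Set where
  here   : r ⊑ r
  left   : ∀ {q₁ q₂} → r ⊑ q₁ → r ⊑ q₁ ∧ q₂
  right  : ∀ {q₁ q₂} → r ⊑ q₂ → r ⊑ q₁ ∧ q₂
  under∃ : ∀ {P q} → r ⊑ q → r ⊑ ∃⟨ P ⟩ q
  under○ : ∀ {q} → r ⊑ q → r ⊑ ○ q
  under◇ : ∀ {q} → r ⊑ q → r ⊑ ◇ q

-- Every occurrence of ○ or ◇ is in the scope of some ∃P.
TemporalOnlyUnder∃ : Query → Set
TemporalOnlyUnder∃ ⊤q         = ⊤
TemporalOnlyUnder∃ (atom A)   = ⊤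
TemporalOnlyUnder∃ (q₁ ∧ q₂)  = TemporalOnlyUnder∃ q₁ × TemporalOnlyUnder∃ q₂
TemporalOnlyUnder∃ (∃⟨ P ⟩ q) = ⊤
TemporalOnlyUnder∃ (○ q)      = ⊥
TemporalOnlyUnder∃ (◇ q)      = ⊥

QueryClass : Set₁
QueryClass = Query → Set

𝒬ₚ[○,◇]⊗ℰℒ : QueryClass
𝒬ₚ[○,◇]⊗ℰℒ q =
  ∀ {q₁ q₂} → q₁ ∧ q₂ ⊑ q → TemporalOnlyUnder∃ q₁ ⊎ TemporalOnlyUnder∃ q₂

∃-Free : Query → Set
∃-Free q = ∀ {P r} → ¬ (∃⟨ P ⟩ r ⊑ q)

No∃UnderTemporal : Query → Set
No∃UnderTemporal q =
  (∀ {r} → ○ r ⊑ q → ∃-Free r) × (∀ {r} → ◇ r ⊑ q → ∃-Free r)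

ℰℒ⟨𝒬ₚ[○,◇]⟩ : QueryClass
ℰℒ⟨𝒬ₚ[○,◇]⟩ q = 𝒬ₚ[○,◇]⊗ℰℒ q × No∃UnderTemporal q

record Example : Set where
  constructor mkExample
  field
    instanceᵀ : TemporalInstance
    point     : Individual
    point∈ind : point ∈ indᵀ instanceᵀ

open Example public

_≈ᴱ_ : Example → Example → Set
e ≈ᴱ e′ = instanceᵀ e ≈ᵀ instanceᵀ e′ × point e ≡ point e′

record ExampleSet : Set where
  constructor mkExampleSet
  field
    E⁺ E⁻     : List Example
    E⁺-unique : AllPairs (λ e e′ → ¬ (e ≈ᴱ e′)) E⁺
    E⁻-unique : AllPairs (λ e e′ → ¬ (e ≈ᴱ e′)) E⁻

open ExampleSet public

sizeᴱ : ExampleSet → ℕ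
sizeᴱ E = sum (map (λ e → sizeᵀ (instanceᵀ e)) (E⁺ E ++ E⁻ E))

_Fits_ : Query → ExampleSet → Set
q Fits E = All (λ e → instanceᵀ e , point e , 0 ⊨ q) (E⁺ E)
         × All (λ e → ¬ (instanceᵀ e , point e , 0 ⊨ q)) (E⁻ E)

_UniquelyCharacterises_Within_ : ExampleSet → Query → QueryClass → Set
E UniquelyCharacterises q Within 𝒬 =
  q Fits E × (∀ q′ → 𝒬 q′ → q′ Fits E → q ≡q q′)

-- Coefficients are listed from the constant term upwards.  Natural coefficients
-- suffice for bounds: on ℕ, any polynomial is bounded by one having them.
Polynomial : Set
Polynomial = List ℕ

eval : Polynomial → ℕ → ℕ
eval f x = foldr (λ c v → c + x * v) 0 f

PolynomiallyCharacterisable : QueryClass → Set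
PolynomiallyCharacterisable 𝒬 =
  Σ[ f ∈ Polynomial ] (∀ q → 𝒬 q →
    Σ[ E ∈ ExampleSet ] (E UniquelyCharacterises q Within 𝒬 × sizeᴱ E ≤ eval f ∣ q ∣))

{-# OPTIONS --safe #-}
-- Let r_s (zigzag s below), for s ∈ {0,1}ⁿ, be a path query whose j-th segment asks for
-- the letter j at two times, consecutive if s_j = 0 and not consecutive if s_j = 1.  Let
-- q_i (looseAt i) say that the same letters occur in the same order in runs of three,
-- which allow both kinds of segments, except that for i only two occurrences at an
-- unspecified distance are required.  A model of q_i has to settle this distance, hence
-- satisfies all r_s with one of the two values of s_i.  So an instance satisfying
-- q = ⋀ᵢ ∃P.q_i refutes at most one ∃P.r_s.  But q ∧ ∃P.r_s is never equivalent to q, so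
-- each s needs its own positive example refuting ∃P.r_s: there are at least 2ⁿ of them,
-- while |q| is quadratic in n.
module Submission where

open import Defs
open import Relation.Nullary.Negation.Core using (¬_)
open import Data.Bool.Base using (Bool; true; false; not)
open import Data.Bool.Properties using (¬-not) renaming (_≟_ to _≟ᵇ_)
open import Data.Fin.Base using (Fin; zero; suc; toℕ)
open import Data.Fin.Properties using (toℕ-injective)
open import Data.List.Base using (List; []; _∷_; _++_; length; map; filter; applyUpTo;
  tabulate; concatMap)
open import Data.List.Membership.Propositional using (_∈_)
open import Data.List.Membership.Propositional.Properties
  using (∈-tabulate⁺; ∈-tabulate⁻; ∈-concatMap⁺)
open import Data.List.NonEmpty.Base using (_∷_; toList)
open import Data.List.Relation.Unary.All using (All; []; _∷_)
import Data.List.Relation.Unary.All as All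
open import Data.List.Relation.Unary.Any using (here; there)
import Data.List.Relation.Unary.Any as Any
open import Data.List.Relation.Unary.Unique.Propositional.Properties using (tabulate⁺)
open import Data.Nat.Base
  using (ℕ; zero; suc; _+_; _*_; _^_; _≤_; _<_; z≤n; s≤s; z<s; s<s; s≤s⁻¹)
open import Data.Nat.ListAction using (sum)
open import Data.Nat.Properties
open import Data.Nat.Solver using (module +-*-Solver)
open import Data.Product.Base using (_×_; _,_; proj₁; proj₂; ∃-syntax; Σ-syntax)
open import Data.Sum.Base using (inj₁; inj₂)
open import Data.Unit.Base using (tt)
open import Data.Vec.Base using (Vec; []; _∷_; lookup; head; tail)
import Data.Vec.Base as Vec
open import Data.Vec.Properties using (lookup∘tabulate)
open import Function.Base using (_∘_)
open import Function.Bundles using (module Equivalence)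
open import Relation.Binary.PropositionalEquality
open import Relation.Nullary.Decidable.Core using (yes; no)

private
  variable
    m n ℓ : ℕ
    a     : Individual
    𝒟     : TemporalInstance

-- The path queries and their conjunction.

step : Bool → Query → Query
step false φ = ○ φ
step true  φ = ○ ◇ φ

-- The letter of a segment is the number of segments left, so letters descend from `n` to 1. In
-- `step`, `○ ◇` reaches exactly the times at least two ahead.
zigzag : Vec Bool n → Query
zigzag []          = ⊤q
zigzag {n} (b ∷ s) = ◇ (atom n ∧ step b (atom n ∧ zigzag s))

run : UnaryPredicate → Query → Query
run A φ = ○ (atom A ∧ ○ (atom A ∧ ○ (atom A ∧ φ)))

runs : ℕ → Query
runs zero    = ⊤q
runs (suc m) = run (suc m) (runs m)

looseAt : Fin n → Query
looseAt {suc m} zero    = ◇ (atom (suc m) ∧ ◇ (atom (suc m) ∧ runs m))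
looseAt {suc m} (suc i) = run (suc m) (looseAt i)

⋀ : (Fin n → Query) → Query
⋀ {zero}  φ = ⊤q
⋀ {suc n} φ = φ zero ∧ ⋀ (φ ∘ suc)

-- Each conjunct has its own `∃⟨ 0 ⟩`, so the `looseAt i` may be satisfied at different individuals.
allLoose : ℕ → Query
allLoose n = ⋀ {n} λ i → ∃⟨ 0 ⟩ looseAt i

⊨⋀⁺ : (φ : Fin n → Query) → (∀ i → 𝒟 , a , ℓ ⊨ φ i) → 𝒟 , a , ℓ ⊨ ⋀ φ
⊨⋀⁺ {zero}  φ h = tt
⊨⋀⁺ {suc n} φ h = h zero , ⊨⋀⁺ (φ ∘ suc) (h ∘ suc)

⊨⋀⁻ : (φ : Fin n → Query) → 𝒟 , a , ℓ ⊨ ⋀ φ → ∀ i → 𝒟 , a , ℓ ⊨ φ i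
⊨⋀⁻ φ (h , _)  zero    = h
⊨⋀⁻ φ (_ , hs) (suc i) = ⊨⋀⁻ (φ ∘ suc) hs i

-- Membership in the class

-- The invariant behind membership: every conjunction has an atom, free of temporal operators, on
-- its left, and `∃⟨ P ⟩` never occurs.
data Path : Query → Set where
  ⊤q   : Path ⊤q
  _∧_  : ∀ A {φ} → Path φ → Path (atom A ∧ φ)
  ○_   : ∀ {φ} → Path φ → Path (○ φ)
  ◇_   : ∀ {φ} → Path φ → Path (◇ φ)

zigzag-path : (s : Vec Bool n) → Path (zigzag s)
zigzag-path []          = ⊤q
zigzag-path (false ∷ s) = ◇ (_ ∧ ○ (_ ∧ zigzag-path s))
zigzag-path (true ∷ s)  = ◇ (_ ∧ ○ ◇ (_ ∧ zigzag-path s))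

run-path : ∀ {A φ} → Path φ → Path (run A φ)
run-path p = ○ (_ ∧ ○ (_ ∧ ○ (_ ∧ p)))

runs-path : ∀ n → Path (runs n)
runs-path zero    = ⊤q
runs-path (suc n) = run-path (runs-path n)

looseAt-path : (i : Fin n) → Path (looseAt i)
looseAt-path {suc m} zero    = ◇ (_ ∧ ◇ (_ ∧ runs-path m))
looseAt-path {suc m} (suc i) = run-path (looseAt-path i)

path⇒∃-free : ∀ {φ} → Path φ → ∃-Free φ
path⇒∃-free (A ∧ p) (left ())
path⇒∃-free (A ∧ p) (right x)  = path⇒∃-free p x
path⇒∃-free (○ p)   (under○ x) = path⇒∃-free p x
path⇒∃-free (◇ p)   (under◇ x) = path⇒∃-free p x

path⇒𝒬ₚ : ∀ {φ} → Path φ → 𝒬ₚ[○,◇]⊗ℰℒ φ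
path⇒𝒬ₚ (A ∧ p) here       = inj₁ tt
path⇒𝒬ₚ (A ∧ p) (left ())
path⇒𝒬ₚ (A ∧ p) (right x)  = path⇒𝒬ₚ p x
path⇒𝒬ₚ (○ p)   (under○ x) = path⇒𝒬ₚ p x
path⇒𝒬ₚ (◇ p)   (under◇ x) = path⇒𝒬ₚ p x

⊑-trans : ∀ {p q r} → p ⊑ q → q ⊑ r → p ⊑ r
⊑-trans x here       = x
⊑-trans x (left y)   = left (⊑-trans x y)
⊑-trans x (right y)  = right (⊑-trans x y)
⊑-trans x (under∃ y) = under∃ (⊑-trans x y)
⊑-trans x (under○ y) = under○ (⊑-trans x y)
⊑-trans x (under◇ y) = under◇ (⊑-trans x y)

∃path∈ℰℒ : ∀ {P φ} → Path φ → ℰℒ⟨𝒬ₚ[○,◇]⟩ (∃⟨ P ⟩ φ)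
∃path∈ℰℒ p = (λ { (under∃ x) → path⇒𝒬ₚ p x })
           , (λ { (under∃ x) y → path⇒∃-free p (⊑-trans (under○ y) x) })
           , (λ { (under∃ x) y → path⇒∃-free p (⊑-trans (under◇ y) x) })

∧∈ℰℒ : ∀ {p q} → TemporalOnlyUnder∃ p →
       ℰℒ⟨𝒬ₚ[○,◇]⟩ p → ℰℒ⟨𝒬ₚ[○,◇]⟩ q → ℰℒ⟨𝒬ₚ[○,◇]⟩ (p ∧ q)
∧∈ℰℒ t (a , b , c) (a′ , b′ , c′) =
    (λ { here → inj₁ t ; (left x) → a x ; (right x) → a′ x })
  , (λ { (left x) → b x ; (right x) → b′ x })
  , (λ { (left x) → c x ; (right x) → c′ x })

⋀∈ℰℒ : (φ : Fin n → Query) → (∀ i → TemporalOnlyUnder∃ (φ i)) →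
       (∀ i → ℰℒ⟨𝒬ₚ[○,◇]⟩ (φ i)) → ℰℒ⟨𝒬ₚ[○,◇]⟩ (⋀ φ)
⋀∈ℰℒ {zero}  φ t h = (λ ()) , (λ ()) , (λ ())
⋀∈ℰℒ {suc n} φ t h = ∧∈ℰℒ (t zero) (h zero) (⋀∈ℰℒ (φ ∘ suc) (t ∘ suc) (h ∘ suc))

allLoose∈ℰℒ : ∀ n → ℰℒ⟨𝒬ₚ[○,◇]⟩ (allLoose n)
allLoose∈ℰℒ n = ⋀∈ℰℒ _ (λ _ → tt) (∃path∈ℰℒ ∘ looseAt-path {n})

zigzag∧allLoose∈ℰℒ : (s : Vec Bool n) → ℰℒ⟨𝒬ₚ[○,◇]⟩ (∃⟨ 0 ⟩ zigzag s ∧ allLoose n)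
zigzag∧allLoose∈ℰℒ s = ∧∈ℰℒ tt (∃path∈ℰℒ (zigzag-path s)) (allLoose∈ℰℒ _)

-- Models of the loose queries

-- The run fills times `1 + ℓ` to `3 + ℓ`: its last two give the consecutive pair, its outer two the
-- other one. Both pairs end at `3 + ℓ`, where the rest of either query is evaluated.
run⇒zigzag : ∀ b (s : Vec Bool m) φ → 𝒟 , a , ℓ ⊨ run (suc m) φ →
             (𝒟 , a , 3 + ℓ ⊨ φ → 𝒟 , a , 3 + ℓ ⊨ zigzag s) → 𝒟 , a , ℓ ⊨ zigzag (b ∷ s)
run⇒zigzag {ℓ = ℓ} false s φ (_ , x , y , h) f = 2 + ℓ , m<n⇒m<1+n (n<1+n _) , x , y , f h
run⇒zigzag {ℓ = ℓ} true s φ (x , _ , y , h) f =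
  1 + ℓ , n<1+n _ , x , 3 + ℓ , n<1+n _ , y , f h

runs⇒zigzag : ∀ n (s : Vec Bool n) → 𝒟 , a , ℓ ⊨ runs n → 𝒟 , a , ℓ ⊨ zigzag s
runs⇒zigzag zero    []      _ = tt
runs⇒zigzag {𝒟} (suc n) (b ∷ s) h = run⇒zigzag {𝒟 = 𝒟} b s (runs n) h (runs⇒zigzag n s)

-- The distance between the two occurrences of the loose letter fixes `b`; every other segment is a
-- run and serves either bit.
looseAt⇒zigzag : (i : Fin n) → 𝒟 , a , ℓ ⊨ looseAt i →
                 ∃[ b ] (∀ s → lookup s i ≡ b → 𝒟 , a , ℓ ⊨ zigzag s)
looseAt⇒zigzag {suc n} zero (t , ℓ<t , x , t′ , t<t′ , y , h) with m≤n⇒m<n∨m≡n t<t′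
... | inj₁ 1+t<t′ = true  , λ { (_ ∷ s) refl → t , ℓ<t , x , t′ , 1+t<t′ , y , runs⇒zigzag n s h }
... | inj₂ refl   = false , λ { (_ ∷ s) refl → t , ℓ<t , x , y , runs⇒zigzag n s h }
looseAt⇒zigzag {suc n} {𝒟} (suc i) h@(_ , _ , _ , h′) with looseAt⇒zigzag i h′
... | b , f = b , λ { (c ∷ s) e → run⇒zigzag {𝒟 = 𝒟} c s (looseAt i) h (λ _ → f s e) }

-- The vector `v` collects the bits fixed by the witnesses of the `looseAt i`. Agreement at a single
-- `i` suffices, since the witness for that `i` then satisfies all of `zigzag s`.
allLoose⇒zigzag : 𝒟 , a , ℓ ⊨ allLoose n →
  Σ[ v ∈ Vec Bool n ] (∀ s i → lookup s i ≡ lookup v i → 𝒟 , a , ℓ ⊨ ∃⟨ 0 ⟩ zigzag s)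
allLoose⇒zigzag {𝒟} {a} {ℓ} {n} h = Vec.tabulate (proj₁ ∘ choice) , λ s i e →
  let b , b∈ , Pab , _ = witness i
  in b , b∈ , Pab , proj₂ (choice i) s (trans e (lookup∘tabulate (proj₁ ∘ choice) i))
  where
  witness : ∀ i → 𝒟 , a , ℓ ⊨ ∃⟨ 0 ⟩ looseAt i
  witness = ⊨⋀⁻ {𝒟 = 𝒟} _ h
  choice : (i : Fin n) → ∃[ c ] (∀ s → lookup s i ≡ c → 𝒟 , proj₁ (witness i) , ℓ ⊨ zigzag s)
  choice i = looseAt⇒zigzag i (proj₂ (proj₂ (proj₂ (witness i))))

-- Vectors agreeing somewhere with each of a few given vectors.

Agree : Vec Bool n → Vec Bool n → Set
Agree s v = ∃[ i ] lookup s i ≡ lookup v i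

tailsWithHead : Bool → List (Vec Bool (suc n)) → List (Vec Bool n)
tailsWithHead b vs = map tail (filter (λ v → head v ≟ᵇ b) vs)

length-tailsWithHead : (vs : List (Vec Bool (suc n))) →
  length (tailsWithHead true vs) + length (tailsWithHead false vs) ≡ length vs
length-tailsWithHead []                  = refl
length-tailsWithHead ((true ∷ _) ∷ vs)  = cong suc (length-tailsWithHead vs)
length-tailsWithHead ((false ∷ _) ∷ vs) = trans (+-suc _ _) (cong suc (length-tailsWithHead vs))

agree-cons : ∀ b {s : Vec Bool n} vs → All (Agree s) (tailsWithHead b vs) → All (Agree (not b ∷ s)) vs
agree-cons b []             hs = []
agree-cons b ((c ∷ v) ∷ vs) hs with c ≟ᵇ b
agree-cons b ((c ∷ v) ∷ vs) ((i , e) ∷ hs) | yes _  = (suc i , e) ∷ agree-cons b vs hs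
agree-cons b ((c ∷ v) ∷ vs) hs             | no c≢b = (zero , sym (¬-not c≢b)) ∷ agree-cons b vs hs

-- A vector qualifies exactly if its complement is missing from `vs`. For one of the two first bits,
-- fewer than `2 ^ n` members start with it: those are handled by the tail, all others by choosing
-- the opposite first bit.
agreeing-vector : ∀ n (vs : List (Vec Bool n)) → length vs < 2 ^ n → ∃[ s ] All (Agree s) vs
agreeing-vector zero    []       _          = [] , []
agreeing-vector zero    (_ ∷ _)  (s≤s ())
agreeing-vector (suc n) vs       short with length (tailsWithHead true vs) <? 2 ^ n
... | yes few = let s , hs = agreeing-vector n _ few in false ∷ s , agree-cons true vs hs
... | no many = let s , hs = agreeing-vector n _ few in true ∷ s , agree-cons false vs hs
  where
  few : length (tailsWithHead false vs) < 2 ^ n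
  few = +-cancelˡ-< (2 ^ n) _ _ (begin-strict
    2 ^ n + length (tailsWithHead false vs)                              ≤⟨ +-monoˡ-≤ _ (≮⇒≥ many) ⟩
    length (tailsWithHead true vs) + length (tailsWithHead false vs)     ≡⟨ length-tailsWithHead vs ⟩
    length vs                                                            <⟨ short ⟩
    2 ^ n + (2 ^ n + 0)                                                  ≡⟨ cong (2 ^ n +_) (+-identityʳ _) ⟩
    2 ^ n + 2 ^ n                                                        ∎)
    where open ≤-Reasoning

-- Countermodels

-- This is `n - toℕ i`, the letter of segment `i` in both `zigzag` and `looseAt`.
level : Fin n → ℕ
level {suc m} zero    = suc m
level {suc m} (suc i) = level i

level≤ : (i : Fin n) → level i ≤ n
level≤ zero    = ≤-refl
level≤ (suc i) = m≤n⇒m≤1+n (level≤ i)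

-- Position `t` will be placed at time `suc t`; time 0 is kept for the edges.
Word : Set
Word = ℕ → UnaryPredicate

prefix : (x y z : UnaryPredicate) → Word → Word
prefix x y z w 0                   = x
prefix x y z w 1                   = y
prefix x y z w 2                   = z
prefix x y z w (suc (suc (suc t))) = w t

runsWord : ℕ → Word
runsWord zero    = λ _ → 0
runsWord (suc m) = prefix (suc m) (suc m) (suc m) (runsWord m)

-- The letter 0, used as padding, occurs in none of the queries.
gapWord : Bool → ℕ → Word
gapWord true  m = prefix 0 (suc m) (suc m) (runsWord m)
gapWord false m = prefix (suc m) 0 (suc m) (runsWord m)

-- Only segment `i` departs from runs of three: its letter occurs there twice, at a distance that
-- bit `i` of `s` rejects.
looseWord : Vec Bool n → Fin n → Word
looseWord {suc m} (b ∷ s) zero    = gapWord b m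
looseWord {suc m} (b ∷ s) (suc i) = prefix (suc m) (suc m) (suc m) (looseWord s i)

runsWord≤ : ∀ m t → runsWord m t ≤ m
runsWord≤ zero    t                   = z≤n
runsWord≤ (suc m) 0                   = ≤-refl
runsWord≤ (suc m) 1                   = ≤-refl
runsWord≤ (suc m) 2                   = ≤-refl
runsWord≤ (suc m) (suc (suc (suc t))) = m≤n⇒m≤1+n (runsWord≤ m t)

runsWord≢ : ∀ m t → runsWord m t ≢ suc m
runsWord≢ m t e = 1+n≰n (subst (_≤ m) e (runsWord≤ m t))

Gap : Bool → ℕ → ℕ → Set
Gap false t t′ = t′ ≡ suc t
Gap true  t t′ = suc t < t′

gap-pred : ∀ b {t t′} → Gap b (suc t) (suc t′) → Gap b t t′
gap-pred false = suc-injective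
gap-pred true  = s≤s⁻¹

-- Earlier segments use larger letters and later ones smaller letters, so `level i` occurs only at
-- the two positions inside segment `i`. Dropping a segment shifts both positions by three, which
-- preserves `Gap`.
no-gap : ∀ (s : Vec Bool n) i {t t′} → looseWord s i t ≡ level i → looseWord s i t′ ≡ level i →
         ¬ Gap (lookup s i) t t′
no-gap (true ∷ s) zero {suc _} {suc (suc (suc t′))} _ e _ = runsWord≢ _ t′ e
no-gap (true ∷ s) zero {suc _} {2} _ _ (s≤s (s≤s ()))
no-gap (true ∷ s) zero {suc _} {1} _ _ (s≤s ())
no-gap (false ∷ s) zero {0} _ () refl
no-gap (false ∷ s) zero {2} _ e refl = runsWord≢ _ 0 e
no-gap (false ∷ s) zero {suc (suc (suc t))} e _ _ = runsWord≢ _ t e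
no-gap {suc m} (b ∷ s) (suc i) {t} {t′} e e′ g = go t t′ e e′ g
  where
  above : suc m ≢ level i
  above e = 1+n≰n (≤-trans (≤-reflexive e) (level≤ i))
  w = looseWord (b ∷ s) (suc i)
  go : ∀ t t′ → w t ≡ level i → w t′ ≡ level i → ¬ Gap (lookup s i) t t′
  go 0 _ e _ _ = above e
  go 1 _ e _ _ = above e
  go 2 _ e _ _ = above e
  go _ 0 _ e _ = above e
  go _ 1 _ e _ = above e
  go _ 2 _ e _ = above e
  go (suc (suc (suc t))) (suc (suc (suc t′))) e e′ g =
    no-gap s i e e′ (gap-pred c (gap-pred c (gap-pred c g)))
    where c = lookup s i

zigzag⇒gap : (s : Vec Bool n) (i : Fin n) → 𝒟 , a , ℓ ⊨ zigzag s →
  ∃[ t ] ∃[ t′ ] ((𝒟 , a , suc t ⊨ atom (level i)) × (𝒟 , a , suc t′ ⊨ atom (level i))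
                  × Gap (lookup s i) t t′)
zigzag⇒gap (false ∷ s) zero (suc t , _ , x , y , _) = t , suc t , x , y , refl
zigzag⇒gap (true ∷ s)  zero (suc t , _ , x , suc t′ , s≤s lt , y , _) = t , t′ , x , y , lt
zigzag⇒gap (false ∷ s) (suc i) (_ , _ , _ , _ , h)         = zigzag⇒gap s i h
zigzag⇒gap (true ∷ s)  (suc i) (_ , _ , _ , _ , _ , _ , h) = zigzag⇒gap s i h

-- Instances that spell words.

Spells : TemporalInstance → Individual → ℕ → Word → ℕ → Set
Spells 𝒟 a ℓ w k = ∀ t → t < k → 𝒟 , a , suc (t + ℓ) ⊨ atom (w t)

spells-tail : ∀ w {k} → Spells 𝒟 a ℓ w (3 + k) → Spells 𝒟 a (3 + ℓ) (w ∘ (3 +_)) k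
spells-tail {𝒟} {a} {ℓ} w h t t<k =
  subst (λ u → 𝒟 , a , suc u ⊨ atom (w (3 + t))) (sym shift) (h (3 + t) (+-monoʳ-< 3 t<k))
  where
  shift : t + (3 + ℓ) ≡ 3 + t + ℓ
  shift = trans (sym (+-assoc t 3 ℓ)) (cong (_+ ℓ) (+-comm t 3))

-- The length is written `n * 3` because `suc n * 3` computes to `3 + n * 3`, the form that
-- `spells-tail` takes.
spells-runs : ∀ n → Spells 𝒟 a ℓ (runsWord n) (n * 3) → 𝒟 , a , ℓ ⊨ runs n
spells-runs zero    h = tt
spells-runs {𝒟} (suc n) h =
    h 0 z<s , h 1 (s<s z<s) , h 2 (s<s (s<s z<s))
  , spells-runs n (spells-tail {𝒟} (runsWord (suc n)) h)

spells-loose : ∀ (s : Vec Bool n) i → Spells 𝒟 a ℓ (looseWord s i) (n * 3) → 𝒟 , a , ℓ ⊨ looseAt i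
spells-loose {suc n} {𝒟} {ℓ = ℓ} (true ∷ s) zero h =
    2 + ℓ , m<n⇒m<1+n (n<1+n _) , h 1 (s<s z<s)
  , 3 + ℓ , n<1+n _ , h 2 (s<s (s<s z<s)) , spells-runs n (spells-tail {𝒟} (gapWord true n) h)
spells-loose {suc n} {𝒟} {ℓ = ℓ} (false ∷ s) zero h =
    1 + ℓ , n<1+n _ , h 0 z<s
  , 3 + ℓ , m<n⇒m<1+n (n<1+n _) , h 2 (s<s (s<s z<s))
  , spells-runs n (spells-tail {𝒟} (gapWord false n) h)
spells-loose {𝒟 = 𝒟} (b ∷ s) (suc i) h =
    h 0 z<s , h 1 (s<s z<s) , h 2 (s<s (s<s z<s))
  , spells-loose s i (spells-tail {𝒟} (looseWord (b ∷ s) (suc i)) h)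

at-applyUpTo : ∀ (f : ℕ → DataInstance) {k t} → t < k → at (applyUpTo f k) t ≡ f t
at-applyUpTo f {suc k} {zero}  _       = refl
at-applyUpTo f {suc k} {suc t} (s≤s h) = at-applyUpTo (f ∘ suc) h

∈-at-applyUpTo⁻ : ∀ (f : ℕ → DataInstance) k t {x} →
                  x ∈ facts (at (applyUpTo f k) t) → x ∈ facts (f t)
∈-at-applyUpTo⁻ f (suc k) zero    h = h
∈-at-applyUpTo⁻ f (suc k) (suc t) h = ∈-at-applyUpTo⁻ (f ∘ suc) k t h

-- Leaf `i` is the individual `toℕ i`, so individual 0 is both the centre and leaf `zero`. The roles
-- do not interfere: edges exist only at time 0 and letters only later.
module Star {n} (words : Fin n → Word) (k : ℕ) where

  edges : DataInstance
  edges = mkInstance (tabulate λ i → binary 0 0 (toℕ {n} i))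
                     (tabulate⁺ λ { e → toℕ-injective (binary-injective e) })
    where
    binary-injective : ∀ {P a b c} → binary P a b ≡ binary P a c → b ≡ c
    binary-injective refl = refl

  letters : ℕ → DataInstance
  letters t = mkInstance (tabulate λ i → unary (words i t) (toℕ i))
                         (tabulate⁺ λ { e → toℕ-injective (unary-injective e) })
    where
    unary-injective : ∀ {A B a b} → unary A a ≡ unary B b → a ≡ b
    unary-injective refl = refl

  star : TemporalInstance
  star = edges ∷ applyUpTo letters k

  edge : ∀ i → binary 0 0 (toℕ i) ∈ facts edges
  edge = ∈-tabulate⁺

  star-⊨∃ : ∀ i φ → star , toℕ i , 0 ⊨ φ → star , 0 , 0 ⊨ ∃⟨ 0 ⟩ φ
  star-⊨∃ i _ h = toℕ i , ∈-concatMap⁺ individuals (Any.map (λ { refl → there (here refl) }) (edge i))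
              , edge i , h

  star-⊨∃⁻ : ∀ φ → star , 0 , 0 ⊨ ∃⟨ 0 ⟩ φ → ∃[ i ] (star , toℕ i , 0 ⊨ φ)
  star-⊨∃⁻ _ (b , _ , Pab , h) with ∈-tabulate⁻ Pab
  ... | i , refl = i , h

  star-spells : ∀ i → Spells star (toℕ i) 0 (words i) k
  star-spells i t t<k rewrite +-identityʳ t | at-applyUpTo letters t<k = ∈-tabulate⁺ i

  star-letter : ∀ i t {A} → star , toℕ i , suc t ⊨ atom A → words i t ≡ A
  star-letter i t h with ∈-tabulate⁻ (∈-at-applyUpTo⁻ letters k t h)
  ... | j , e = same j e
    where
    same : ∀ j {A} → unary A (toℕ i) ≡ unary (words j t) (toℕ j) → words i t ≡ A
    same j e with toℕ-injective {i = i} {j = j} (cong individual e)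
      where individual : Fact → Individual
            individual (unary _ a)    = a
            individual (binary _ a _) = a
    same j refl | refl = refl

-- In the star whose leaf `i` spells `looseWord s i`, that leaf satisfies `looseAt i`, while
-- `no-gap` refutes `zigzag s` at every leaf.
allLoose⊭zigzag : (s : Vec Bool n) → ¬ (allLoose n ≡q ∃⟨ 0 ⟩ zigzag s ∧ allLoose n)
allLoose⊭zigzag {n} s equiv =
  let i , h = star-⊨∃⁻ (zigzag s) (proj₁ (Equivalence.to (equiv star 0 0) holds))
      t , t′ , x , y , g = zigzag⇒gap {𝒟 = star} s i h
  in no-gap s i (star-letter i t x) (star-letter i t′ y) g
  where
  open Star (looseWord s) (n * 3)
  holds : star , 0 , 0 ⊨ allLoose n
  holds = ⊨⋀⁺ {𝒟 = star} _ λ i → star-⊨∃ i (looseAt i) (spells-loose {𝒟 = star} s i (star-spells i))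

-- Sizes of examples

-- An individual of the instance occurs in some fact. Hence the number of examples bounds the size
-- from below.
0<sizeᵀ : ∀ 𝒟 → a ∈ indᵀ 𝒟 → 0 < sizeᵀ 𝒟
0<sizeᵀ 𝒟 = go (toList 𝒟)
  where
  go : ∀ 𝒜s → a ∈ concatMap ind 𝒜s → 0 < sum (map (length ∘ facts) 𝒜s)
  go (mkInstance []      _ ∷ 𝒜s) h = go 𝒜s h
  go (mkInstance (_ ∷ _) _ ∷ 𝒜s) h = z<s

length≤sizeᴱ : ∀ E → length (E⁺ E) ≤ sizeᴱ E
length≤sizeᴱ E = go (E⁺ E)
  where
  go : ∀ es → length es ≤ sum (map (sizeᵀ ∘ instanceᵀ) (es ++ E⁻ E))
  go []       = z≤n
  go (e ∷ es) = +-mono-≤ (0<sizeᵀ (instanceᵀ e) (point∈ind e)) (go es)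

characterisation-size : ∀ n E → E UniquelyCharacterises allLoose n Within ℰℒ⟨𝒬ₚ[○,◇]⟩ →
                        2 ^ n ≤ sizeᴱ E
characterisation-size n E ((pos , neg) , unique) = ≮⇒≥ λ small →
  -- Each positive example contributes one vector and has size at least 1, so there are fewer than
  -- `2 ^ n` vectors.
  let s , agree = agreeing-vector n (choices pos)
                    (≤-<-trans (≤-reflexive (length-choices pos))
                               (≤-<-trans (length≤sizeᴱ E) small))
  in allLoose⊭zigzag s (unique _ (zigzag∧allLoose∈ℰℒ s)
       -- The conjunction implies `allLoose n`, so it fails on every negative example.
       (positive s pos agree , All.map (λ ¬h (_ , h) → ¬h h) neg))
  where
  Holds : Query → Example → Set
  Holds φ e = instanceᵀ e , point e , 0 ⊨ φ

  choices : ∀ {es} → All (Holds (allLoose n)) es → List (Vec Bool n)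
  choices = All.reduce (proj₁ ∘ allLoose⇒zigzag)

  length-choices : ∀ {es} (hs : All (Holds (allLoose n)) es) → length (choices hs) ≡ length es
  length-choices []       = refl
  length-choices (h ∷ hs) = cong suc (length-choices hs)

  positive : ∀ s {es} (hs : All (Holds (allLoose n)) es) → All (Agree s) (choices hs) →
             All (Holds (∃⟨ 0 ⟩ zigzag s ∧ allLoose n)) es
  positive s []       []             = []
  positive s (h ∷ hs) ((i , e) ∷ as) =
    (proj₂ (allLoose⇒zigzag h) s i e , h) ∷ positive s hs as

-- Growth of polynomials and exponentials

∣runs∣ : ∀ n → ∣ runs n ∣ ≡ 1 + 9 * n
∣runs∣ zero    = refl
∣runs∣ (suc n) rewrite ∣runs∣ n =
  solve 1 (λ n → con 9 :+ (con 1 :+ con 9 :* n) := con 1 :+ con 9 :* (con 1 :+ n)) refl n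
  where open +-*-Solver

-- The loose segment has six symbols, a run nine.
∣looseAt∣≤ : (i : Fin n) → ∣ looseAt i ∣ ≤ ∣ runs n ∣
∣looseAt∣≤ {suc n} zero    = +-monoˡ-≤ ∣ runs n ∣ {6} {9} (m≤m+n 6 3)
∣looseAt∣≤ {suc n} (suc i) = +-monoʳ-≤ 9 (∣looseAt∣≤ i)

∣⋀∣≤ : ∀ (φ : Fin n → Query) {k} → (∀ i → ∣ φ i ∣ ≤ k) → ∣ ⋀ φ ∣ ≤ 1 + n * (1 + k)
∣⋀∣≤ {zero}  φ     h = ≤-refl
∣⋀∣≤ {suc n} φ {k} h = begin
  1 + ∣ φ zero ∣ + ∣ ⋀ (φ ∘ suc) ∣  ≤⟨ +-mono-≤ (s≤s (h zero)) (∣⋀∣≤ (φ ∘ suc) (h ∘ suc)) ⟩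
  1 + k + (1 + n * (1 + k))         ≡⟨ +-suc (1 + k) _ ⟩
  1 + (1 + k + n * (1 + k))         ∎
  where open ≤-Reasoning

-- Restricting to `n = 2 ^ k` turns the quadratic bound into a power of two with exponent linear in
-- `k`.
∣allLoose∣≤ : ∀ k → ∣ allLoose (2 ^ k) ∣ ≤ 2 ^ (4 + (k + k))
∣allLoose∣≤ k = begin
  ∣ allLoose N ∣              ≤⟨ ∣⋀∣≤ {N} _ (λ i → +-monoʳ-≤ 2 (≤-trans (∣looseAt∣≤ i) (≤-reflexive (∣runs∣ N)))) ⟩
  1 + N * (4 + 9 * N)         ≤⟨ +-mono-≤ (*-mono-≤ 1≤N 1≤N) (*-monoʳ-≤ N (+-monoˡ-≤ (9 * N) (*-monoʳ-≤ 4 1≤N))) ⟩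
  N * N + N * (4 * N + 9 * N) ≡⟨
    solve 1 (λ N → N :* N :+ N :* (con 4 :* N :+ con 9 :* N) := con 14 :* (N :* N)) refl N ⟩
  14 * (N * N)                ≤⟨ *-monoˡ-≤ (N * N) (m≤m+n 14 2) ⟩
  2 ^ 4 * (N * N)             ≡⟨ cong (2 ^ 4 *_) (^-distribˡ-+-* 2 k k) ⟨
  2 ^ 4 * 2 ^ (k + k)         ≡⟨ ^-distribˡ-+-* 2 4 (k + k) ⟨
  2 ^ (4 + (k + k))           ∎
  where
  open ≤-Reasoning
  open +-*-Solver
  N = 2 ^ k
  1≤N : 1 ≤ N
  1≤N = m^n>0 2 k

n<2^n : ∀ n → n < 2 ^ n
n<2^n zero    = z<s
n<2^n (suc n) = +-mono-≤ (m^n>0 2 n) (≤-trans (n<2^n n) (m≤m+n _ 0))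

eval-mono : ∀ f {x y} → x ≤ y → eval f x ≤ eval f y
eval-mono []      x≤y = z≤n
eval-mono (c ∷ f) x≤y = +-monoʳ-≤ c (*-mono-≤ x≤y (eval-mono f x≤y))

-- Each coefficient `c` is absorbed through `suc c ≤ 2 ^ c`, each factor `2 ^ m` adds `m` to the
-- exponent.
eval-2^ : ∀ f m → eval f (2 ^ m) ≤ 2 ^ (sum f + m * length f)
eval-2^ []      m = z≤n
eval-2^ (c ∷ f) m = begin
  c + 2 ^ m * eval f (2 ^ m)  ≤⟨ +-monoʳ-≤ c (*-monoʳ-≤ (2 ^ m) (eval-2^ f m)) ⟩
  c + 2 ^ m * 2 ^ e           ≡⟨ cong (c +_) (^-distribˡ-+-* 2 m e) ⟨
  c + y                       ≤⟨ +-monoˡ-≤ y (≤-trans (≤-reflexive (sym (*-identityʳ c))) (*-monoʳ-≤ c (m^n>0 2 (m + e)))) ⟩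
  c * y + y                   ≡⟨ +-comm (c * y) y ⟩
  suc c * y                   ≤⟨ *-monoˡ-≤ y (n<2^n c) ⟩
  2 ^ c * y                   ≡⟨ ^-distribˡ-+-* 2 c (m + e) ⟨
  2 ^ (c + (m + e))           ≡⟨ cong (2 ^_) (
    solve 4 (λ c m s l → c :+ (m :+ (s :+ m :* l)) := (c :+ s) :+ m :* (con 1 :+ l))
      refl c m (sum f) (length f)) ⟩
  2 ^ (sum (c ∷ f) + m * length (c ∷ f)) ∎
  where
  open ≤-Reasoning
  open +-*-Solver
  e = sum f + m * length f
  y = 2 ^ (m + e)

linear<exponential : ∀ a b → ∃[ k ] b + k * a < 2 ^ k
-- With `j = b + 2a` the left side is at most `j + j * j`, which lies below the square of `suc j`.
linear<exponential a b = j + j , (begin-strict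
  b + (j + j) * a        ≡⟨ cong (b +_) (solve 2 (λ j a → (j :+ j) :* a := j :* (a :+ a)) refl j a) ⟩
  b + j * (a + a)        ≤⟨ +-mono-≤ (m≤m+n b (a + a)) (*-monoʳ-≤ j (m≤n+m (a + a) b)) ⟩
  j + j * j              <⟨ m<n+m (j + j * j) {suc j} z<s ⟩
  suc j + (j + j * j)    ≡⟨ cong (suc j +_) (*-suc j j) ⟨
  suc j * suc j          ≤⟨ *-mono-≤ (n<2^n j) (n<2^n j) ⟩
  2 ^ j * 2 ^ j          ≡⟨ ^-distribˡ-+-* 2 j j ⟨
  2 ^ (j + j)            ∎)
  where
  open ≤-Reasoning
  open +-*-Solver
  j = b + (a + a)

-- At `n = 2 ^ k` both sides are powers of two, up to the bounds above; it remains to compare an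
-- exponent linear in `k` with `2 ^ k`.
polynomial<exponential : ∀ f → ∃[ n ] eval f ∣ allLoose n ∣ < 2 ^ n
polynomial<exponential f = 2 ^ k , (begin-strict
  eval f ∣ allLoose (2 ^ k) ∣      ≤⟨ eval-mono f (∣allLoose∣≤ k) ⟩
  eval f (2 ^ (4 + (k + k)))       ≤⟨ eval-2^ f (4 + (k + k)) ⟩
  2 ^ (sum f + (4 + (k + k)) * d)  ≡⟨ cong (2 ^_) (
    solve 3 (λ s k d → s :+ (con 4 :+ (k :+ k)) :* d := (s :+ con 4 :* d) :+ k :* (d :+ d))
      refl (sum f) k d) ⟩
  2 ^ (sum f + 4 * d + k * (d + d)) <⟨ ^-monoʳ-< 2 (s≤s (s≤s z≤n)) (proj₂ bound) ⟩
  2 ^ (2 ^ k)                      ∎)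
  where
  open ≤-Reasoning
  open +-*-Solver
  d = length f
  bound = linear<exponential (d + d) (sum f + 4 * d)
  k = proj₁ bound

theorem26 : ¬ (PolynomiallyCharacterisable ℰℒ⟨𝒬ₚ[○,◇]⟩)
theorem26 (f , characterise) =
  let n , f<2^n        = polynomial<exponential f
      E , unique , E≤f = characterise (allLoose n) (allLoose∈ℰℒ n)
  in <⇒≱ f<2^n (≤-trans (characterisation-size n E unique) E≤f)
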